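{- Let $k\ge 1$ and $r\ge 2$ be integers and let $d_1\ge d_2\ge \cdots\ge d_k$ be positive integers. Then for all sufficiently large $n$, $$ex_r\Big(n,\bigcup_{i=1}^k S^+_{d_i}\Big)=\max_{1\le i\le k}\left\{\binom{n}{r}-\binom{n-i+1}{r}+ex_r\big(n-i+1,S^+_{d_i}\big)\right\}.$$
   Context: For a family (or single) $r$-uniform hypergraph $\mathcal F$, $ex_r(n,\mathcal F)$ denotes the maximum number of hyperedges in an $n$-vertex $r$-uniform hypergraph containing no member of $\mathcal F$ as a (not necessarily induced) subhypergraph. $S_\ell$ denotes the star $K_{1,\ell}$ with $\ell$ edges. For a graph $F$ and $r\ge 2$, the expansion $F^+$ is the $r$-uniform hypergraph obtained from $F$ by adding $r-2$ new vertices to each edge, all added vertices being distinct (so for $r=2$, $F^+=F$). $\bigcup_{i=1}^k S^+_{d_i}$ denotes the vertex-disjoint union of the hypergraphs $S^+_{d_1},\dots,S^+_{d_k}$. -}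

module Defs where

open import Data.Empty using (⊥)
open import Data.Fin as Fin using (Fin; zero; suc; funToFin; finToFun)
open import Data.Fin.Properties
  using (any?; all?; inj⇒≟; +↔⊎; *↔×; 2↔Bool; injective⇒≤; finToFun-funToFin)
open import Data.Fin.Subset using (Subset; _∈_; ∣_∣)
open import Data.Fin.Subset.Properties using (_∈?_; anySubset?)
open import Data.List using (List; []; _∷_; length; lookup)
open import Data.List.Membership.Propositional.Properties using (∈-lookup)
open import Data.List.Relation.Unary.All as All using (All)
open import Data.List.Relation.Unary.AllPairs as AllPairs using (_∷_)
open import Data.List.Relation.Unary.Unique.Propositional using (Unique)
open import Data.Nat using (ℕ; zero; suc; _+_; _*_; _∸_; _^_; _≤_; z≤n; s≤s; _≟_)
open import Data.Nat.Properties using (m≤n⇒m<n∨m≡n)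
open import Data.Product using (∃; ∃-syntax; _×_; _,_)
open import Data.Product.Function.NonDependent.Propositional using (_×-↔_)
open import Data.Sum using (_⊎_; inj₁; inj₂)
open import Data.Sum.Function.Propositional using (_⊎-↔_)
open import Data.Vec as Vec using ()
open import Data.Vec.Properties using (≡-dec; tabulate∘lookup; tabulate-cong)
import Data.Vec.Functional as F
import Data.Bool.Properties as Bool
open import Function using (_∘_; Inverse; Equivalence; _⇔_; mk⇔; _↔_; Injective; Injection)
open import Function.Construct.Composition using (_↔-∘_)
open import Function.Construct.Identity using (↔-id)
open import Function.Construct.Symmetry using (↔-sym)
open import Function.Properties.Inverse using (Inverse⇒Injection)
open import Relation.Binary.Definitions using (DecidableEquality)
open import Relation.Binary.PropositionalEquality
  using (_≡_; _≗_; refl; sym; trans; cong; subst)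
open import Relation.Nullary using (¬_; Dec; yes; no; ¬?; contradiction)
open import Relation.Nullary.Decidable using (map′; _×-dec_; _⊎-dec_; _→-dec_)
open import Relation.Unary using (Decidable)

-- Vertices and edges are arbitrary finite types, so that new vertices can
-- be adjoined as summands; an edge stands for its set of vertices.
record Hypergraph : Set₁ where
  field
    Vertex   : Set
    Edge     : Set
    _∈ₑ_     : Vertex → Edge → Set
    _∈ₑ?_    : ∀ v e → Dec (v ∈ₑ e)
    order    : ℕ
    size     : ℕ
    vertices : Fin order ↔ Vertex
    edges    : Fin size ↔ Edge

open Hypergraph

private
  any-finite? : ∀ {m} {A : Set} → Fin m ↔ A →
                {P : A → Set} → Decidable P → Dec (∃ P)
  any-finite? A↔ {P} P? = map′
    (λ (i , p) → to i , p)
    (λ (a , p) → from a , subst P (sym (strictlyInverseˡ a)) p)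
    (any? (P? ∘ to))
    where open Inverse A↔

  all-finite? : ∀ {m} {A : Set} → Fin m ↔ A →
                {P : A → Set} → Decidable P → Dec (∀ a → P a)
  all-finite? A↔ {P} P? = map′
    (λ p a → subst P (strictlyInverseˡ a) (p (from a)))
    (λ p i → p (to i))
    (all? (P? ∘ to))
    where open Inverse A↔

  ≡-finite? : ∀ {m} {A : Set} → Fin m ↔ A → DecidableEquality A
  ≡-finite? A↔ = inj⇒≟ (Inverse⇒Injection (↔-sym A↔))

  ⇔-dec : {A B : Set} → Dec A → Dec B → Dec (A ⇔ B)
  ⇔-dec A? B? = map′ (λ (f , g) → mk⇔ f g)
    (λ e → Equivalence.to e , Equivalence.from e)
    ((A? →-dec B?) ×-dec (B? →-dec A?))

-- K_{1,ℓ}: the centre is 0 and the i-th edge is {0, i+1}.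
star : ℕ → Hypergraph
star ℓ = record
  { Vertex   = Fin (suc ℓ)
  ; Edge     = Fin ℓ
  ; _∈ₑ_     = λ v i → v ≡ zero ⊎ v ≡ suc i
  ; _∈ₑ?_    = λ v i → (v Fin.≟ zero) ⊎-dec (v Fin.≟ suc i)
  ; order    = suc ℓ
  ; size     = ℓ
  ; vertices = ↔-id _
  ; edges    = ↔-id _
  }

-- The new vertices are the pairs (e , j) with j < r - 2, and (e , j) lies
-- on the edge e only.  The result is r-uniform when F is a graph and r ≥ 2.
expansion : ℕ → Hypergraph → Hypergraph
expansion r F = record
  { Vertex   = Vertex F ⊎ (Edge F × Fin (r ∸ 2))
  ; Edge     = Edge F
  ; _∈ₑ_     = λ { (inj₁ v) e → _∈ₑ_ F v e ; (inj₂ (e′ , _)) e → e′ ≡ e }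
  ; _∈ₑ?_    = λ { (inj₁ v) e → _∈ₑ?_ F v e
                 ; (inj₂ (e′ , _)) e → ≡-finite? (edges F) e′ e }
  ; order    = order F + size F * (r ∸ 2)
  ; size     = size F
  ; vertices = (vertices F ⊎-↔ ((edges F ×-↔ ↔-id _) ↔-∘ *↔×)) ↔-∘ +↔⊎
  ; edges    = edges F
  }

∅ : Hypergraph
∅ = record
  { Vertex   = Fin 0
  ; Edge     = Fin 0
  ; _∈ₑ_     = λ _ _ → ⊥
  ; _∈ₑ?_    = λ _ _ → no λ ()
  ; order    = 0
  ; size     = 0
  ; vertices = ↔-id _
  ; edges    = ↔-id _
  }

infixr 6 _⊍_

_⊍_ : Hypergraph → Hypergraph → Hypergraph
F ⊍ G = record
  { Vertex   = Vertex F ⊎ Vertex G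
  ; Edge     = Edge F ⊎ Edge G
  ; _∈ₑ_     = λ { (inj₁ v) (inj₁ e) → _∈ₑ_ F v e
                 ; (inj₂ v) (inj₂ e) → _∈ₑ_ G v e
                 ; (inj₁ _) (inj₂ _) → ⊥
                 ; (inj₂ _) (inj₁ _) → ⊥ }
  ; _∈ₑ?_    = λ { (inj₁ v) (inj₁ e) → _∈ₑ?_ F v e
                 ; (inj₂ v) (inj₂ e) → _∈ₑ?_ G v e
                 ; (inj₁ _) (inj₂ _) → no λ ()
                 ; (inj₂ _) (inj₁ _) → no λ () }
  ; order    = order F + order G
  ; size     = size F + size G
  ; vertices = (vertices F ⊎-↔ vertices G) ↔-∘ +↔⊎
  ; edges    = (edges F ⊎-↔ edges G) ↔-∘ +↔⊎
  }

⨄ : ∀ {k} → (Fin k → Hypergraph) → Hypergraph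
⨄ {zero}  _ = ∅
⨄ {suc k} F = F zero ⊍ ⨄ (F ∘ suc)

-- The image of the vertex set of every edge of F is that of an edge of G.
record IsEmbedding (F G : Hypergraph) (f : Vertex F → Vertex G) : Set where
  field
    injective : Injective _≡_ _≡_ f
    edge      : ∀ e → ∃[ e′ ] ∀ w →
                _∈ₑ_ G w e′ ⇔ (∃[ v ] _∈ₑ_ F v e × f v ≡ w)

infix 4 _⊑_ _⊑?_

_⊑_ : Hypergraph → Hypergraph → Set
F ⊑ G = ∃[ f ] IsEmbedding F G f

private
  isEmbedding? : ∀ F G → Decidable (IsEmbedding F G)
  isEmbedding? F G f = map′
    (λ (inj , e) → record { injective = λ {x} {y} → inj x y ; edge = e })
    (λ emb → (λ x y → IsEmbedding.injective emb) , IsEmbedding.edge emb)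
    (all-finite? VF (λ x → all-finite? VF λ y →
       (f x ≟ᴳ f y) →-dec ≡-finite? VF x y)
     ×-dec
     all-finite? (edges F) λ e → any-finite? (edges G) λ e′ →
       all-finite? (vertices G) λ w → ⇔-dec (_∈ₑ?_ G w e′)
         (any-finite? VF λ v → _∈ₑ?_ F v e ×-dec (f v ≟ᴳ w)))
    where
    VF = vertices F
    _≟ᴳ_ = ≡-finite? (vertices G)

  isEmbedding-resp : ∀ F G {f g} → f ≗ g → IsEmbedding F G f → IsEmbedding F G g
  isEmbedding-resp F G f≗g emb = record
    { injective = λ {x} {y} gx≡gy →
        injective (trans (f≗g x) (trans gx≡gy (sym (f≗g y))))
    ; edge = λ e → let (e′ , h) = edge e in e′ , λ w → mk⇔
        (λ w∈ → let (v , v∈ , eq) = Equivalence.to (h w) w∈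
                in v , v∈ , trans (sym (f≗g v)) eq)
        (λ (v , v∈ , eq) → Equivalence.from (h w) (v , v∈ , trans (f≗g v) eq))
    }
    where open IsEmbedding emb

  any-function? : ∀ m {n} {B : Set} → Fin n ↔ B → {P : (Fin m → B) → Set} →
                  (∀ {f g} → f ≗ g → P f → P g) → Decidable P → Dec (∃ P)
  any-function? zero B↔ resp P? = map′
    (λ p → F.[] , p) (λ (f , p) → resp (λ ()) p) (P? F.[])
  any-function? (suc m) B↔ resp P? = map′
    (λ (b , f , p) → (b F.∷ f) , p)
    (λ (f , p) → f zero , f ∘ suc ,
       resp (λ { zero → refl ; (suc _) → refl }) p)
    (any-finite? B↔ λ b → any-function? m B↔
       (λ f≗g → resp λ { zero → refl ; (suc i) → f≗g i })
       (λ f → P? (b F.∷ f)))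

_⊑?_ : ∀ F G → Dec (F ⊑ G)
F ⊑? G = map′
  (λ (f , emb) → f ∘ from , emb)
  (λ (f , emb) → f ∘ to ,
     isEmbedding-resp F G (λ v → cong f (sym (strictlyInverseˡ v))) emb)
  (any-function? (order F) (vertices G)
     (λ f≗g → isEmbedding-resp F G (f≗g ∘ from))
     (λ f → isEmbedding? F G (f ∘ from)))
  where open Inverse (vertices F)

record UniformHypergraph (r n : ℕ) : Set where
  constructor uniformHypergraph
  field
    edgeList : List (Subset n)
    uniform  : All (λ e → ∣ e ∣ ≡ r) edgeList
    distinct : Unique edgeList

open UniformHypergraph

#edges : ∀ {r n} → UniformHypergraph r n → ℕ
#edges H = length (edgeList H)

fromList : ∀ {n} → List (Subset n) → Hypergraph
fromList {n} es = record
  { Vertex   = Fin n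
  ; Edge     = Fin (length es)
  ; _∈ₑ_     = λ v i → v ∈ lookup es i
  ; _∈ₑ?_    = λ v i → v ∈? lookup es i
  ; order    = n
  ; size     = length es
  ; vertices = ↔-id _
  ; edges    = ↔-id _
  }

⌊_⌋ : ∀ {r n} → UniformHypergraph r n → Hypergraph
⌊ H ⌋ = fromList (edgeList H)

Attains : (r n : ℕ) → Hypergraph → ℕ → Set
Attains r n F m = ∃[ H ] ¬ (F ⊑ ⌊ H ⌋) × #edges {r} {n} H ≡ m

private
  any-list? : ∀ {n} m {P : List (Subset n) → Set} → Decidable P →
              Dec (∃[ es ] P es × length es ≡ m)
  any-list? zero P? = map′
    (λ p → [] , p , refl) (λ { ([] , p , _) → p }) (P? [])
  any-list? (suc m) P? = map′
    (λ (e , es , p , eq) → e ∷ es , p , cong suc eq)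
    (λ { (e ∷ es , p , refl) → e , es , p , refl })
    (anySubset? λ e → any-list? m (λ es → P? (e ∷ es)))

  attains? : ∀ r n F → Decidable (Attains r n F)
  attains? r n F m = map′
    (λ (es , (u , d , free) , eq) → uniformHypergraph es u d , free , eq)
    (λ (H , free , eq) → edgeList H , (uniform H , distinct H , free) , eq)
    (any-list? m λ es →
       All.all? (λ e → ∣ e ∣ ≟ r) es ×-dec
       AllPairs.allPairs? (λ p q → ¬? (≡-dec Bool._≟_ p q)) es ×-dec
       ¬? (F ⊑? fromList es))

  greatest : {P : ℕ → Set} → Decidable P → ℕ → ℕ
  greatest P? zero = zero
  greatest P? (suc b) with P? (suc b)
  ... | yes _ = suc b
  ... | no  _ = greatest P? b

  greatest-upper : {P : ℕ → Set} (P? : Decidable P) → ∀ b {m} →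
                   m ≤ b → P m → m ≤ greatest P? b
  greatest-upper P? zero m≤b p = m≤b
  greatest-upper P? (suc b) m≤1+b p with P? (suc b)
  ... | yes _ = m≤1+b
  ... | no ¬p with m≤n⇒m<n∨m≡n m≤1+b
  ...   | inj₁ (s≤s m≤b) = greatest-upper P? b m≤b p
  ...   | inj₂ refl      = contradiction p ¬p

  greatest-attained : {P : ℕ → Set} (P? : Decidable P) → ∀ b {m} →
                      m ≤ b → P m → P (greatest P? b)
  greatest-attained P? zero z≤n p = p
  greatest-attained P? (suc b) m≤1+b p with P? (suc b)
  ... | yes q = q
  ... | no ¬p with m≤n⇒m<n∨m≡n m≤1+b
  ...   | inj₁ (s≤s m≤b) = greatest-attained P? b m≤b p
  ...   | inj₂ refl      = contradiction p ¬p

  lookup-injective : {A : Set} {xs : List A} → Unique xs →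
                     Injective _≡_ _≡_ (lookup xs)
  lookup-injective (_ ∷ _) {zero}  {zero}  _  = refl
  lookup-injective {xs = _ ∷ xs} (x≢ ∷ _) {zero}  {suc j} eq =
    contradiction eq (All.lookup x≢ (∈-lookup j))
  lookup-injective {xs = _ ∷ xs} (x≢ ∷ _) {suc i} {zero}  eq =
    contradiction (sym eq) (All.lookup x≢ (∈-lookup i))
  lookup-injective (_ ∷ u) {suc i} {suc j} eq = cong suc (lookup-injective u eq)

  #edges≤2^n : ∀ {r n} (H : UniformHypergraph r n) → #edges H ≤ 2 ^ n
  #edges≤2^n {n = n} H =
    injective⇒≤ {f = code ∘ lookup (edgeList H)}
      λ eq → lookup-injective (distinct H) (code-injective eq)
    where
    open Inverse 2↔Bool
    bits : Subset n → Fin n → Fin 2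
    bits p = from ∘ Vec.lookup p
    code : Subset n → Fin (2 ^ n)
    code = funToFin ∘ bits
    lookup≗ : ∀ {p q} → code p ≡ code q → Vec.lookup p ≗ Vec.lookup q
    lookup≗ {p} {q} eq i = Injection.injective
      (Inverse⇒Injection (↔-sym 2↔Bool))
      (trans (sym (finToFun-funToFin (bits p) i))
        (trans (cong (λ c → finToFun c i) eq) (finToFun-funToFin (bits q) i)))
    code-injective : ∀ {p q} → code p ≡ code q → p ≡ q
    code-injective {p} {q} eq = trans (sym (tabulate∘lookup p))
      (trans (tabulate-cong (lookup≗ {p} {q} eq)) (tabulate∘lookup q))

-- The search bound 2 ^ n is harmless, as ex-upper and ex-attained show; the
-- value is 0 if every hypergraph contains F (possible only if F has no edge).
ex : (r n : ℕ) → Hypergraph → ℕ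
ex r n F = greatest (attains? r n F) (2 ^ n)

ex-upper : ∀ {r n} F (H : UniformHypergraph r n) →
           ¬ (F ⊑ ⌊ H ⌋) → #edges H ≤ ex r n F
ex-upper {r} {n} F H free =
  greatest-upper (attains? r n F) (2 ^ n) (#edges≤2^n H) (H , free , refl)

ex-attained : ∀ {r n} F (H₀ : UniformHypergraph r n) → ¬ (F ⊑ ⌊ H₀ ⌋) →
              ∃[ H ] ¬ (F ⊑ ⌊ H ⌋) × #edges {r} {n} H ≡ ex r n F
ex-attained {r} {n} F H₀ free =
  greatest-attained (attains? r n F) (2 ^ n) (#edges≤2^n H₀) (H₀ , free , refl)

{-# OPTIONS --safe #-}

-- Write S for the first star expansion and G for the union of the other ones.
-- For large n,
--   ex r (1+n) (S ⊍ G) = max (ex r (1+n) S) (C(n,r-1) + ex r n G),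
-- and the right-hand side of the theorem obeys the same recursion, so induction
-- on k applies.  Lower bound: add to a G-free hypergraph on n vertices all edges
-- through a new vertex; at most one star uses that vertex, and the stars before
-- it contain their successors.  Upper bound: let H be (S ⊍ G)-free but contain
-- S.  If some vertex has degree larger than a constant times C(n-1,r-2), deleting
-- it leaves a G-free hypergraph, as a star at that vertex can be chosen greedily
-- to avoid any copy of G.  Otherwise only O(C(n-1,r-2)) ≤ C(n,r-1) edges meet a
-- given copy of S; deleting them and one vertex of S leaves a G-free hypergraph.
module Submission where

open import Defs
open import Data.Bool.Base using (true; false)
open import Data.Fin as Fin using (Fin; toℕ; zero; suc; punchIn; punchOut; inject≤)
open import Data.Fin.Properties
  using (any?; toℕ-inject₁; suc-injective; inject≤-injective; punchIn-injective; punchInᵢ≢i;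
         punchIn-punchOut)
open import Data.Fin.Subset using (Subset; inside; outside; _∈_; ∣_∣)
open import Data.Fin.Subset.Properties using (_∈?_; drop-there)
open import Data.List using (List; []; _∷_; _++_; length; map; filter; tabulate; lookup)
open import Data.List.Extrema.Nat using (max; max≤v⁺; v≤max⁺; xs≤max)
open import Data.List.Membership.Propositional using (lose; find)
  renaming (_∈_ to _∈ₗ_; _∉_ to _∉ₗ_)
open import Data.List.Membership.Propositional.Properties
  using (∈-lookup; ∈-map⁻; ∈-++⁺ˡ; ∈-++⁺ʳ; ∈-++⁻; ∈-filter⁻; ∈-tabulate⁺; ∈-tabulate⁻)
open import Data.List.Properties using (length-map; length-++; length-tabulate; tabulate-cong)
import Data.List.Relation.Binary.Sublist.Propositional.Properties as Sublist
open import Data.List.Relation.Unary.All as All using (All; []; _∷_)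
open import Data.List.Relation.Unary.All.Properties as All using (all-filter; ¬Any⇒All¬)
open import Data.List.Relation.Unary.AllPairs using ([]; _∷_)
open import Data.List.Relation.Unary.Any as Any using (Any; here; there; index)
open import Data.List.Relation.Unary.Any.Properties using (lookup-index)
open import Data.List.Relation.Unary.Unique.Propositional using (Unique)
import Data.List.Relation.Unary.Unique.Propositional.Properties as Unique
open import Data.Nat using (ℕ; zero; suc; _+_; _*_; _∸_; _⊔_; _≤_; _<_; z≤n; s≤s; _<?_)
open import Data.Nat.Combinatorics using (_C_; nC1≡n; nCk+nC[k+1]≡[n+1]C[k+1])
open import Data.Nat.Properties renaming (suc-injective to suc-injectiveᴺ)
open import Data.Product using (∃-syntax; _×_; _,_; proj₁; proj₂)
open import Data.Sum using (_⊎_; inj₁; inj₂; [_,_])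
open import Data.Sum.Properties using (inj₁-injective; inj₂-injective)
open import Data.Vec using ([]; _∷_; here; there; insertAt; removeAt) renaming (lookup to lookupᵛ)
open import Data.Vec.Properties
  using (insertAt-removeAt; insertAt-punchIn; ∷-injectiveʳ; []=⇒lookup; lookup⇒[]=)
open import Function using (_∘_; case_of_; _⇔_; mk⇔; Equivalence; Inverse; Injective)
open import Relation.Binary.PropositionalEquality
  using (_≡_; _≢_; refl; sym; trans; cong; cong₂; subst; module ≡-Reasoning)
open import Relation.Nullary using (¬_; yes; no; ¬?; contradiction)
open import Relation.Nullary.Decidable using (decidable-stable)
open import Relation.Unary using (Decidable)

open Hypergraph
open UniformHypergraph
open IsEmbedding
open Equivalence using (to; from)

-- Embeddings

∘-isEmbedding : ∀ {F G H f g} → IsEmbedding G H g → IsEmbedding F G f → IsEmbedding F H (g ∘ f)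
∘-isEmbedding {g = g} gE fE = record
  { injective = injective fE ∘ injective gE
  ; edge = λ e →
      let (e′ , h) = edge fE e
          (e″ , h′) = edge gE e′
      in e″ , λ w → mk⇔
        (λ w∈ → let (u , u∈ , gu≡w) = to (h′ w) w∈
                    (v , v∈ , fv≡u) = to (h u) u∈
                in v , v∈ , trans (cong g fv≡u) gu≡w)
        (λ (v , v∈ , eq) → from (h′ w) (_ , from (h _) (v , v∈ , refl) , eq))
  }

⊑-trans : ∀ {F G H} → F ⊑ G → G ⊑ H → F ⊑ H
⊑-trans (f , fE) (g , gE) = g ∘ f , ∘-isEmbedding gE fE

inj₁-isEmbedding : ∀ F G → IsEmbedding F (F ⊍ G) inj₁
inj₁-isEmbedding F G = record
  { injective = inj₁-injective
  ; edge = λ e → inj₁ e , λ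
      { (inj₁ v) → mk⇔ (λ v∈ → v , v∈ , refl) (λ { (_ , v∈ , refl) → v∈ })
      ; (inj₂ _) → mk⇔ (λ ()) (λ { (_ , _ , ()) }) }
  }

inj₂-isEmbedding : ∀ F G → IsEmbedding G (F ⊍ G) inj₂
inj₂-isEmbedding F G = record
  { injective = inj₂-injective
  ; edge = λ e → inj₂ e , λ
      { (inj₁ _) → mk⇔ (λ ()) (λ { (_ , _ , ()) })
      ; (inj₂ v) → mk⇔ (λ v∈ → v , v∈ , refl) (λ { (_ , v∈ , refl) → v∈ }) }
  }

⊍-isEmbedding : ∀ {F G H f g} → IsEmbedding F H f → IsEmbedding G H g →
                (∀ x y → f x ≢ g y) → IsEmbedding (F ⊍ G) H [ f , g ]
⊍-isEmbedding {F} {G} {H} {f} {g} fE gE f≢g = record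
  { injective = λ {x} {y} → inj x y
  ; edge = λ
      { (inj₁ e) → let (e′ , h) = edge fE e in e′ , λ w → mk⇔
          (λ w∈ → let (v , v∈ , eq) = to (h w) w∈ in inj₁ v , v∈ , eq)
          (λ { (inj₁ v , v∈ , eq) → from (h w) (v , v∈ , eq) })
      ; (inj₂ e) → let (e′ , h) = edge gE e in e′ , λ w → mk⇔
          (λ w∈ → let (v , v∈ , eq) = to (h w) w∈ in inj₂ v , v∈ , eq)
          (λ { (inj₂ v , v∈ , eq) → from (h w) (v , v∈ , eq) }) }
  }
  where
  inj : ∀ x y → [ f , g ] x ≡ [ f , g ] y → x ≡ y
  inj (inj₁ x) (inj₁ y) eq = cong inj₁ (injective fE eq)
  inj (inj₁ x) (inj₂ y) eq = contradiction eq (f≢g x y)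
  inj (inj₂ x) (inj₁ y) eq = contradiction (sym eq) (f≢g y x)
  inj (inj₂ x) (inj₂ y) eq = cong inj₂ (injective gE eq)

⊍∅-⊑ : ∀ {F H} → F ⊑ H → F ⊍ ∅ ⊑ H
⊍∅-⊑ (f , fE) = [ f , (λ ()) ] ,
  ⊍-isEmbedding fE (record { injective = λ { {()} } ; edge = λ () }) (λ _ ())

image : ∀ F {A : Set} → (Vertex F → A) → List A
image F f = tabulate (f ∘ Inverse.to (vertices F))

∈-image : ∀ F {A : Set} (f : Vertex F → A) x → f x ∈ₗ image F f
∈-image F f x = subst (λ y → f y ∈ₗ image F f) (strictlyInverseˡ x)
  (∈-tabulate⁺ (Inverse.from (vertices F) x))
  where open Inverse (vertices F) using (strictlyInverseˡ)

NoIsolatedVertex : Hypergraph → Set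
NoIsolatedVertex F = ∀ v → ∃[ e ] _∈ₑ_ F v e


module _ {F : Hypergraph} {n} {es : List (Subset n)} {f : Vertex F → Fin n} where

  -- Edges of `fromList es` are positions in a list. This lemma and the next trade positions for the
  -- sets themselves, so that later arguments can speak of list membership.
  edgeSet : IsEmbedding F (fromList es) f →
            ∀ e → ∃[ S ] S ∈ₗ es × (∀ w → w ∈ S ⇔ (∃[ v ] _∈ₑ_ F v e × f v ≡ w))
  edgeSet fE e = let (i , h) = edge fE e in lookup es i , ∈-lookup i , h

  isEmbedding-fromList :
    Injective _≡_ _≡_ f →
    (∀ e → ∃[ S ] S ∈ₗ es × (∀ w → w ∈ S ⇔ (∃[ v ] _∈ₑ_ F v e × f v ≡ w))) →
    IsEmbedding F (fromList es) f
  isEmbedding-fromList inj h = record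
    { injective = inj
    ; edge = λ e → let (S , S∈ , hS) = h e in
        index S∈ , λ w → subst (λ T → w ∈ T ⇔ _) (lookup-index S∈) (hS w)
    }

-- Deleting a vertex from a family of sets

lookup-removeAt : ∀ {n} (S : Subset (suc n)) v x →
                  lookupᵛ (removeAt S v) x ≡ lookupᵛ S (punchIn v x)
lookup-removeAt S v x = trans
  (sym (insertAt-punchIn (removeAt S v) v (lookupᵛ S v) x))
  (cong (λ T → lookupᵛ T (punchIn v x)) (insertAt-removeAt S v))

∈-removeAt⁺ : ∀ {n} (S : Subset (suc n)) v {x} → punchIn v x ∈ S → x ∈ removeAt S v
∈-removeAt⁺ S v {x} x∈ = lookup⇒[]= x _ (trans (lookup-removeAt S v x) ([]=⇒lookup x∈))

∈-removeAt⁻ : ∀ {n} (S : Subset (suc n)) v {x} → x ∈ removeAt S v → punchIn v x ∈ S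
∈-removeAt⁻ S v {x} x∈ =
  lookup⇒[]= _ S (trans (sym (lookup-removeAt S v x)) ([]=⇒lookup x∈))

∉⇒lookup : ∀ {n} {S : Subset n} {v} → ¬ v ∈ S → lookupᵛ S v ≡ false
∉⇒lookup {S = S} {v} v∉ with lookupᵛ S v in eq
... | false = refl
... | true  = contradiction (lookup⇒[]= v S eq) v∉

removeAt-injective : ∀ {n} {S T : Subset (suc n)} v → lookupᵛ S v ≡ lookupᵛ T v →
                     removeAt S v ≡ removeAt T v → S ≡ T
removeAt-injective {S = S} {T} v p q = trans (sym (insertAt-removeAt S v))
  (trans (cong₂ (λ R → insertAt R v) q p) (insertAt-removeAt T v))

∣∣-removeAt-∈ : ∀ {n} {S : Subset (suc n)} {v} → v ∈ S → ∣ S ∣ ≡ suc ∣ removeAt S v ∣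
∣∣-removeAt-∈ here = refl
∣∣-removeAt-∈ {S = inside  ∷ _ ∷ _} (there v∈) = cong suc (∣∣-removeAt-∈ v∈)
∣∣-removeAt-∈ {S = outside ∷ _ ∷ _} (there v∈) = ∣∣-removeAt-∈ v∈

∣∣-removeAt-∉ : ∀ {n} {S : Subset (suc n)} {v} → ¬ v ∈ S → ∣ S ∣ ≡ ∣ removeAt S v ∣
∣∣-removeAt-∉ {S = inside  ∷ _}     {zero}  v∉ = contradiction here v∉
∣∣-removeAt-∉ {S = outside ∷ _}     {zero}  v∉ = refl
∣∣-removeAt-∉ {S = inside  ∷ _ ∷ _} {suc v} v∉ = cong suc (∣∣-removeAt-∉ (v∉ ∘ there))
∣∣-removeAt-∉ {S = outside ∷ _ ∷ _} {suc v} v∉ = ∣∣-removeAt-∉ (v∉ ∘ there)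

-- Injectivity is asked for on `P` only: removing a vertex identifies a set with its union with that
-- vertex, but is injective on the sets containing the vertex and on those omitting it.
Unique-map : ∀ {A B : Set} {P : A → Set} {f : A → B} →
             (∀ {x y} → P x → P y → f x ≡ f y → x ≡ y) →
             ∀ {xs} → All P xs → Unique xs → Unique (map f xs)
Unique-map inj [] [] = []
Unique-map inj (px ∷ pxs) (x≢ ∷ u) =
  All.map⁺ (All.zipWith (λ (py , x≢y) eq → x≢y (inj px py eq)) (pxs , x≢))
    ∷ Unique-map inj pxs u

All-map : ∀ {A B : Set} {P : A → Set} {Q : B → Set} {f : A → B} →
          (∀ {x} → P x → Q (f x)) → ∀ {xs} → All P xs → All Q (map f xs)
All-map h = All.map⁺ ∘ All.map h

-- Counting

filter-All : ∀ {A : Set} {P : A → Set} {Q : A → Set} (Q? : Decidable Q) {xs} →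
             All P xs → All P (filter Q? xs)
filter-All Q? pxs = All.tabulate λ x∈ → All.lookup pxs (proj₁ (∈-filter⁻ Q? x∈))

length-filter-¬ : ∀ {A : Set} {P : A → Set} (P? : Decidable P) xs →
                  length xs ≡ length (filter P? xs) + length (filter (¬? ∘ P?) xs)
length-filter-¬ P? [] = refl
length-filter-¬ P? (x ∷ xs) with P? x
... | yes _ = cong suc (length-filter-¬ P? xs)
... | no  _ = trans (cong suc (length-filter-¬ P? xs)) (sym (+-suc _ _))

length-filter-filter : ∀ {A : Set} {P Q : A → Set} (P? : Decidable P) (Q? : Decidable Q) xs →
                       length (filter P? (filter Q? xs)) ≤ length (filter P? xs)
length-filter-filter P? Q? xs = Sublist.length-mono-≤
  (Sublist.filter⁺ P? P? (λ { refl p → p }) (Sublist.filter-⊆ Q? xs))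

-- A union bound over `W`. At most `B` sets contain the first vertex; the others must meet the rest
-- of `W`, and filtering does not increase degrees.
length-meeting : ∀ {n B} (W : List (Fin n)) (xs : List (Subset n)) →
                 All (λ S → Any (_∈ S) W) xs →
                 (∀ w → w ∈ₗ W → length (filter (w ∈?_) xs) ≤ B) →
                 length xs ≤ length W * B
length-meeting [] [] _ _ = z≤n
length-meeting [] (_ ∷ _) (() ∷ _) _
length-meeting {n} (w ∷ W) xs meets bound = subst (_≤ _) (sym (length-filter-¬ (w ∈?_) xs))
  (+-mono-≤ (bound w (here refl))
    (length-meeting W rest
      (All.tabulate λ S∈ → let (S∈xs , w∉) = ∈-filter⁻ w∉? S∈ in
        Any.tail w∉ (All.lookup meets S∈xs))
      (λ u u∈ → ≤-trans (length-filter-filter (u ∈?_) w∉? xs) (bound u (there u∈)))))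
  where
  w∉? : Decidable (λ S → ¬ w ∈ S)
  w∉? = ¬? ∘ (w ∈?_)
  rest = filter w∉? xs

UniformList : ∀ {n} → ℕ → List (Subset n) → Set
UniformList r = All (λ S → ∣ S ∣ ≡ r)

removeAt-∈ : ∀ {n r} v {xs : List (Subset (suc n))} → All (v ∈_) xs →
             Unique xs → UniformList (suc r) xs →
             let ys = map (λ S → removeAt S v) xs in Unique ys × UniformList r ys
removeAt-∈ v v∈ u r =
  Unique-map (λ p q → removeAt-injective v (trans ([]=⇒lookup p) (sym ([]=⇒lookup q)))) v∈ u ,
  All.map⁺ (All.zipWith (λ (p , eq) → suc-injectiveᴺ (trans (sym (∣∣-removeAt-∈ p)) eq)) (v∈ , r))

removeAt-∉ : ∀ {n r} v {xs : List (Subset (suc n))} → All (λ S → ¬ v ∈ S) xs →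
             Unique xs → UniformList r xs →
             let ys = map (λ S → removeAt S v) xs in Unique ys × UniformList r ys
removeAt-∉ v v∉ u r =
  Unique-map (λ p q → removeAt-injective v (trans (∉⇒lookup p) (sym (∉⇒lookup q)))) v∉ u ,
  All.map⁺ (All.zipWith (λ (p , eq) → trans (sym (∣∣-removeAt-∉ p)) eq) (v∉ , r))

-- By Pascal's rule: the sets through `zero` and the sets omitting it are counted separately, and on
-- each half removing `zero` is injective.
length≤C : ∀ {n} r {xs : List (Subset n)} → Unique xs → UniformList r xs → length xs ≤ n C r
length-star≤C : ∀ {n} r v {xs : List (Subset (suc n))} → All (v ∈_) xs →
                Unique xs → UniformList (suc r) xs → length xs ≤ n C r

length≤C {zero} r [] [] = z≤n
length≤C {zero} .0 {[] ∷ []} ([] ∷ []) (refl ∷ []) = s≤s z≤n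
length≤C {zero} r {[] ∷ [] ∷ _} ((≢ ∷ _) ∷ _) _ = contradiction refl ≢
length≤C {suc n} r {xs} u h = subst (_≤ _) (sym (length-filter-¬ (zero ∈?_) xs)) (bound r h)
  where
  0∉? : Decidable (λ (S : Subset (suc n)) → ¬ zero ∈ S)
  0∉? = ¬? ∘ (zero ∈?_)

  without : ∀ r → UniformList r xs → length (filter 0∉? xs) ≤ n C r
  without r h = subst (_≤ n C r) (length-map _ (filter 0∉? xs))
    (let (u′ , h′) = removeAt-∉ zero (all-filter 0∉? xs) (Unique.filter⁺ 0∉? u) (filter-All 0∉? h)
     in length≤C r u′ h′)

  none : ∀ {ys : List (Subset (suc n))} → All (zero ∈_) ys → UniformList 0 ys → length ys ≡ 0
  none [] [] = refl
  none {(inside ∷ _) ∷ _} (here ∷ _) (() ∷ _)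

  bound : ∀ r → UniformList r xs →
          length (filter (zero ∈?_) xs) + length (filter 0∉? xs) ≤ suc n C r
  -- Pascal's rule does not cover `r = 0`; here the first half is empty, since a set through `zero`
  -- has positive size.
  bound zero h = subst (λ k → k + length (filter 0∉? xs) ≤ 1)
    (sym (none (all-filter (zero ∈?_) xs) (filter-All (zero ∈?_) h))) (without 0 h)
  bound (suc r) h = subst (_ ≤_) (nCk+nC[k+1]≡[n+1]C[k+1] n r)
    (+-mono-≤
      (length-star≤C r zero (all-filter (zero ∈?_) xs)
        (Unique.filter⁺ (zero ∈?_) u) (filter-All (zero ∈?_) h))
      (without (suc r) h))

length-star≤C r v {xs} v∈ u h = subst (_≤ _) (length-map _ xs)
  (let (u′ , h′) = removeAt-∈ v v∈ u h in length≤C r u′ h′)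

-- After `v` is removed, all sets still share the vertex that `w` has become, so they form a star on
-- one vertex fewer.
length-pair≤C : ∀ {m} q {v w} → w ≢ v → {xs : List (Subset (suc (suc m)))} →
                All (v ∈_) xs → All (w ∈_) xs →
                Unique xs → UniformList (suc (suc q)) xs → length xs ≤ m C q
length-pair≤C q {v} w≢v {xs} v∈ w∈ u h = subst (_≤ _) (length-map _ xs)
  (let (u′ , h′) = removeAt-∈ v v∈ u h in
   length-star≤C q (punchOut (w≢v ∘ sym))
     (All-map (λ {S} p → ∈-removeAt⁺ S v
       (subst (_∈ S) (sym (punchIn-punchOut (w≢v ∘ sym))) p)) w∈)
     u′ h′)

-- Monotonicity and growth of binomial coefficients

C-mono-suc : ∀ n r → n C r ≤ suc n C r
C-mono-suc n zero    = ≤-refl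
C-mono-suc n (suc r) = subst (n C suc r ≤_) (nCk+nC[k+1]≡[n+1]C[k+1] n r) (m≤n+m _ _)

C-mono : ∀ {m n} r → m ≤ n → m C r ≤ n C r
C-mono {m} {n} r m≤n with m≤n⇒m<n∨m≡n m≤n
... | inj₂ refl      = ≤-refl
... | inj₁ (s≤s m≤p) = ≤-trans (C-mono r m≤p) (C-mono-suc _ r)

-- The absorption identity, by induction on `n` with Pascal's rule before and after the induction
-- hypothesis.
[1+k]*[1+n]C[1+k]≡[1+n]*nCk : ∀ n k → suc k * (suc n C suc k) ≡ suc n * (n C k)
[1+k]*[1+n]C[1+k]≡[1+n]*nCk zero    zero    = refl
[1+k]*[1+n]C[1+k]≡[1+n]*nCk zero    (suc k) = *-zeroʳ k
[1+k]*[1+n]C[1+k]≡[1+n]*nCk (suc n) zero    =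
  trans (*-identityˡ (suc (suc n) C 1)) (trans (nC1≡n (suc (suc n))) (sym (*-identityʳ _)))
[1+k]*[1+n]C[1+k]≡[1+n]*nCk (suc n) (suc k) = begin
  suc (suc k) * (suc (suc n) C suc (suc k))
    ≡⟨ cong (suc (suc k) *_) (nCk+nC[k+1]≡[n+1]C[k+1] (suc n) (suc k)) ⟨
  suc (suc k) * (a + b)
    ≡⟨ *-distribˡ-+ (suc (suc k)) a b ⟩
  -- One copy of `a` splits off by the definition of `_*_`, which leaves two products of the form in
  -- the induction hypothesis.
  a + suc k * a + suc (suc k) * b
    ≡⟨ cong₂ (λ x y → a + x + y) ([1+k]*[1+n]C[1+k]≡[1+n]*nCk n k)
                                 ([1+k]*[1+n]C[1+k]≡[1+n]*nCk n (suc k)) ⟩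
  a + suc n * (n C k) + suc n * (n C suc k)
    ≡⟨ +-assoc a _ _ ⟩
  a + (suc n * (n C k) + suc n * (n C suc k))
    ≡⟨ cong (a +_) (*-distribˡ-+ (suc n) (n C k) (n C suc k)) ⟨
  a + suc n * (n C k + n C suc k)
    ≡⟨ cong (λ x → a + suc n * x) (nCk+nC[k+1]≡[n+1]C[k+1] n k) ⟩
  suc (suc n) * a ∎
  where
  open ≡-Reasoning
  a = suc n C suc k
  b = suc n C suc (suc k)

-- By absorption the ratio of the two coefficients is (n+1)/(k+1), so a large `n` absorbs any
-- constant `c`.
*C≤C : ∀ {n} c k → suc k * c ≤ suc n → c * (n C k) ≤ suc n C suc k
*C≤C {n} c k large = *-cancelˡ-≤ (suc k) (begin
  suc k * (c * (n C k))     ≡⟨ *-assoc (suc k) c (n C k) ⟨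
  suc k * c * (n C k)       ≤⟨ *-monoˡ-≤ (n C k) large ⟩
  suc n * (n C k)           ≡⟨ [1+k]*[1+n]C[1+k]≡[1+n]*nCk n k ⟨
  suc k * (suc n C suc k)   ∎)
  where open ≤-Reasoning
-- Finding a star at a vertex of large degree

enumerate : ∀ {n c} (S : Subset n) → ∣ S ∣ ≡ c →
            ∃[ p ] Injective {A = Fin c} _≡_ _≡_ p × (∀ w → w ∈ S ⇔ (∃[ j ] p j ≡ w))
enumerate [] refl = (λ ()) , (λ { {()} }) , (λ ())
enumerate (outside ∷ S) eq =
  let (p , inj , h) = enumerate S eq in
  suc ∘ p , inj ∘ suc-injective , λ
    { zero    → mk⇔ (λ ()) (λ ())
    ; (suc w) → mk⇔ (λ { (there w∈) → let (j , eq) = to (h w) w∈ in j , cong suc eq })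
                    (λ (j , eq) → there (from (h w) (j , suc-injective eq))) }
enumerate {c = suc c} (inside ∷ S) refl =
  let (p , inj , h) = enumerate S refl
      p′ : Fin (suc c) → Fin _
      p′ = λ { zero → zero ; (suc j) → suc (p j) }
  in
  p′ ,
  (λ { {zero} {zero} _ → refl ; {suc i} {suc j} eq → cong suc (inj (suc-injective eq)) }) , λ
    { zero    → mk⇔ (λ _ → zero , refl) (λ _ → here)
    ; (suc w) → mk⇔ (λ { (there w∈) → let (j , eq) = to (h w) w∈ in suc j , cong suc eq })
                    (λ { (suc j , eq) → there (from (h w) (j , suc-injective eq)) }) }

enumerateLink : ∀ {n c} {S : Subset (suc n)} {v} → v ∈ S → ∣ S ∣ ≡ suc c →
                ∃[ p ] Injective {A = Fin c} _≡_ _≡_ p × (∀ j → p j ≢ v) ×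
                  (∀ w → w ∈ S ⇔ (w ≡ v ⊎ ∃[ j ] p j ≡ w))
enumerateLink {S = S} {v} v∈ size =
  let (p , inj , h) = enumerate (removeAt S v)
        (suc-injectiveᴺ (trans (sym (∣∣-removeAt-∈ v∈)) size))
  in
  punchIn v ∘ p , inj ∘ punchIn-injective v _ _ , (λ j → punchInᵢ≢i v (p j)) ,
  λ w → mk⇔
    (λ w∈ → case w Fin.≟ v of λ
      { (yes w≡v) → inj₁ w≡v
      ; (no  w≢v) →
          let eq = punchIn-punchOut (w≢v ∘ sym)
              (j , pj≡) = to (h _) (∈-removeAt⁺ S v (subst (_∈ S) (sym eq) w∈))
          in inj₂ (j , trans (cong (punchIn v) pj≡) eq) })
    (λ { (inj₁ refl) → v∈
       ; (inj₂ (j , refl)) → ∈-removeAt⁻ S v (from (h _) (j , refl)) })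

Avoids Meets : ∀ {n} → List (Fin n) → Subset n → Set
Meets  W S = Any (_∈ S) W
Avoids W S = ¬ Meets W S

meets? : ∀ {n} (W : List (Fin n)) → Decidable (Meets W)
meets? W S = Any.any? (_∈? S) W

-- If every edge met `W`, the union bound `length-meeting` would contradict the number of edges.
avoiding : ∀ {n B} (W : List (Fin n)) (es : List (Subset n)) →
           (∀ w → w ∈ₗ W → length (filter (w ∈?_) es) ≤ B) → length W * B < length es →
           ∃[ S ] S ∈ₗ es × Avoids W S
avoiding W es bound many with Any.any? (¬? ∘ meets? W) es
... | yes some = find some
... | no  none = contradiction
  (length-meeting W es (All.map (decidable-stable (meets? W _)) (¬Any⇒All¬ es none)) bound)
  (<⇒≱ many)

module Sunflower {n q B} (es : List (Subset (suc n))) (v : Fin (suc n))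
                 (v∈ : All (v ∈_) es) (size : UniformList (suc (suc q)) es)
                 (codegree : ∀ w → w ≢ v → length (filter (w ∈?_) es) ≤ B) where

  -- A sunflower with kernel `v` and `d` petals that miss `W`. Petals are stored by coordinates;
  -- joint injectivity makes them disjoint and free of repeated vertices.
  record Petals (d : ℕ) (W : List (Fin (suc n))) : Set where
    field
      petal   : Fin d → Fin (suc q) → Fin (suc n)
      distinctPetals : ∀ {i j i′ j′} → petal i j ≡ petal i′ j′ → i ≡ i′ × j ≡ j′
      ≢centre : ∀ i j → petal i j ≢ v
      ∉W      : ∀ i j → petal i j ∉ₗ W
      isEdge  : ∀ i → ∃[ S ] S ∈ₗ es × (∀ w → w ∈ S ⇔ (w ≡ v ⊎ ∃[ j ] petal i j ≡ w))

  -- Greedy choice: take an edge that avoids `W`, add its petal to `W` and continue. The bound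
  -- reserves `suc q` vertices for each petal still to come, so a step leaves it unchanged.
  petals : ∀ d W → v ∉ₗ W → (length W + d * suc q) * B < length es → Petals d W
  petals zero W _ _ = record
    { petal = λ () ; distinctPetals = λ { {()} } ; ≢centre = λ () ; ∉W = λ () ; isEdge = λ () }
  petals (suc d) W v∉W many = record
    { petal   = petal′
    ; distinctPetals = λ {i} {j} {i′} {j′} → distinct′ i j i′ j′
    ; ≢centre = λ { zero → p≢v ; (suc i) → P.≢centre i }
    ; ∉W      = λ { zero j p∈ → avoids (lose p∈ (from (S≈ _) (inj₂ (j , refl))))
                  ; (suc i) j p∈ → P.∉W i j (∈-++⁺ʳ (tabulate p) p∈) }
    ; isEdge  = λ { zero → S , S∈ , S≈ ; (suc i) → P.isEdge i }
    }
    where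
    next = avoiding W es (λ w w∈ → codegree w λ { refl → v∉W w∈ })
      (≤-<-trans (*-monoˡ-≤ B (m≤m+n (length W) _)) many)
    S = proj₁ next
    S∈ = proj₁ (proj₂ next)
    avoids = proj₂ (proj₂ next)
    link = enumerateLink (All.lookup v∈ S∈) (All.lookup size S∈)
    p = proj₁ link
    p-injective = proj₁ (proj₂ link)
    p≢v = proj₁ (proj₂ (proj₂ link))
    S≈ = proj₂ (proj₂ (proj₂ link))
    W′ = tabulate p ++ W
    length-W′ : length W′ + d * suc q ≡ length W + suc d * suc q
    length-W′ = begin
      length W′ + d * suc q             ≡⟨ cong (_+ d * suc q) (length-++ (tabulate p)) ⟩
      length (tabulate p) + length W + d * suc q
        ≡⟨ cong (λ x → x + length W + d * suc q) (length-tabulate p) ⟩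
      suc q + length W + d * suc q      ≡⟨ cong (_+ d * suc q) (+-comm (suc q) (length W)) ⟩
      length W + suc q + d * suc q      ≡⟨ +-assoc (length W) (suc q) _ ⟩
      length W + suc d * suc q          ∎
      where open ≡-Reasoning
    rest : Petals d W′
    rest = petals d W′
      (λ v∈ → case ∈-++⁻ (tabulate p) v∈ of λ
        { (inj₁ v∈p) → let (j , eq) = ∈-tabulate⁻ {f = p} v∈p in p≢v j (sym eq)
        ; (inj₂ v∈W) → v∉W v∈W })
      (subst (λ x → x * B < length es) (sym length-W′) many)
    module P = Petals rest
    petal′ : Fin (suc d) → Fin (suc q) → Fin (suc n)
    petal′ zero    = p
    petal′ (suc i) = P.petal i
    fresh : ∀ i j j′ → P.petal i j ≢ p j′
    fresh i j j′ eq = P.∉W i j (∈-++⁺ˡ (subst (_∈ₗ tabulate p) (sym eq) (∈-tabulate⁺ {f = p} j′)))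
    distinct′ : ∀ i j i′ j′ → petal′ i j ≡ petal′ i′ j′ → i ≡ i′ × j ≡ j′
    distinct′ zero    j zero     j′ eq = refl , p-injective eq
    distinct′ zero    j (suc i′) j′ eq = contradiction (sym eq) (fresh i′ j′ j)
    distinct′ (suc i) j zero     j′ eq = contradiction eq (fresh i j j′)
    distinct′ (suc i) j (suc i′) j′ eq =
      let (i≡ , j≡) = P.distinctPetals eq in cong suc i≡ , j≡

  star-avoiding : ∀ d W → v ∉ₗ W → (length W + d * suc q) * B < length es →
                  ∃[ f ] IsEmbedding (expansion (suc (suc q)) (star d)) (fromList es) f ×
                         (∀ x → f x ∉ₗ W)
  star-avoiding d W v∉W many = f , isEmbedding-fromList (λ {x} {y} → inj x y) edge′ , f∉W
    where
    open Petals (petals d W v∉W many)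
    F = expansion (suc (suc q)) (star d)
    f : Vertex F → Fin (suc n)
    f (inj₁ zero)    = v
    -- Coordinate `zero` of a petal serves as the leaf of the star, the other `q` as the vertices
    -- added by the expansion.
    f (inj₁ (suc i)) = petal i zero
    f (inj₂ (i , j)) = petal i (suc j)
    f∉W : ∀ x → f x ∉ₗ W
    f∉W (inj₁ zero)    = v∉W
    f∉W (inj₁ (suc i)) = ∉W i zero
    f∉W (inj₂ (i , j)) = ∉W i (suc j)
    inj : ∀ x y → f x ≡ f y → x ≡ y
    inj (inj₁ zero)    (inj₁ zero)    eq = refl
    inj (inj₁ zero)    (inj₁ (suc i)) eq = contradiction (sym eq) (≢centre i zero)
    inj (inj₁ zero)    (inj₂ (i , j)) eq = contradiction (sym eq) (≢centre i (suc j))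
    inj (inj₁ (suc i)) (inj₁ zero)    eq = contradiction eq (≢centre i zero)
    inj (inj₂ (i , j)) (inj₁ zero)    eq = contradiction eq (≢centre i (suc j))
    inj (inj₁ (suc i)) (inj₁ (suc k)) eq with refl , _ ← distinctPetals eq = refl
    inj (inj₁ (suc i)) (inj₂ (k , l)) eq with () ← proj₂ (distinctPetals eq)
    inj (inj₂ (i , j)) (inj₁ (suc k)) eq with () ← proj₂ (distinctPetals eq)
    inj (inj₂ (i , j)) (inj₂ (k , l)) eq with refl , refl ← distinctPetals eq = refl
    edge′ : ∀ e → ∃[ S ] S ∈ₗ es × (∀ w → w ∈ S ⇔ (∃[ x ] _∈ₑ_ F x e × f x ≡ w))
    edge′ i = let (S , S∈ , S≈) = isEdge i in S , S∈ , λ w → mk⇔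
      (λ w∈ → case to (S≈ w) w∈ of λ
        { (inj₁ refl)           → inj₁ zero , inj₁ refl , refl
        ; (inj₂ (zero  , refl)) → inj₁ (suc i) , inj₂ refl , refl
        ; (inj₂ (suc j , refl)) → inj₂ (i , j) , refl , refl })
      (λ { (inj₁ _ , inj₁ refl , refl) → from (S≈ w) (inj₁ refl)
         ; (inj₁ _ , inj₂ refl , refl) → from (S≈ w) (inj₂ (zero , refl))
         ; (inj₂ (_ , j) , refl , refl) → from (S≈ w) (inj₂ (suc j , refl)) })

-- Deleting the edges that meet W, and then the vertex v ∈ W

avoids? : ∀ {n} (W : List (Fin n)) → Decidable (Avoids W)
avoids? W = ¬? ∘ meets? W

module Deletion {r n} (H : UniformHypergraph r (suc n)) (W : List (Fin (suc n)))
                {v : Fin (suc n)} (v∈W : v ∈ₗ W) where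

  es = edgeList H
  kept = filter (avoids? W) es

  v∉kept : All (λ S → ¬ v ∈ S) kept
  v∉kept = All.map (λ avoids v∈ → avoids (lose v∈W v∈)) (all-filter (avoids? W) es)

  deletion : UniformHypergraph r n
  deletion =
    let (u , h) = removeAt-∉ v v∉kept (Unique.filter⁺ (avoids? W) (distinct H))
                                      (filter-All (avoids? W) (uniform H))
    in uniformHypergraph (map (λ S → removeAt S v) kept) h u

  #edges-deletion : #edges H ≡ length (filter (meets? W) es) + #edges deletion
  #edges-deletion = trans (length-filter-¬ (meets? W) es)
    (cong (length (filter (meets? W) es) +_) (sym (length-map (λ S → removeAt S v) kept)))

  edge⁻ : ∀ {S′} → S′ ∈ₗ edgeList deletion →
          ∃[ S ] S ∈ₗ es × Avoids W S × S′ ≡ removeAt S v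
  edge⁻ S′∈ =
    let (S , S∈ , eq) = ∈-map⁻ (λ S → removeAt S v) S′∈
        (S∈es , avoids) = ∈-filter⁻ (avoids? W) S∈
    in S , S∈es , avoids , eq

  punchIn-isEmbedding : IsEmbedding ⌊ deletion ⌋ ⌊ H ⌋ (punchIn v)
  punchIn-isEmbedding = isEmbedding-fromList (punchIn-injective v _ _) λ e →
    let (S , S∈ , avoids , eq) = edge⁻ (∈-lookup e) in
    S , S∈ , λ w → subst (λ S′ → w ∈ S ⇔ (∃[ x ] x ∈ S′ × punchIn v x ≡ w)) (sym eq) (mk⇔
      (λ w∈ →
        let v≢w : v ≢ w
            v≢w = λ { refl → avoids (lose v∈W w∈) }
            eq′ = punchIn-punchOut v≢w
        in punchOut v≢w , ∈-removeAt⁺ S v (subst (_∈ S) (sym eq′) w∈) , eq′)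
      (λ { (x , x∈ , refl) → ∈-removeAt⁻ S v x∈ }))

  -- Only `v` is removed, so other vertices of `W` survive, but no kept edge contains them. A vertex
  -- of `G` lies on an edge and hence cannot be mapped to them.
  avoids-deletion : ∀ {G g} → NoIsolatedVertex G → IsEmbedding G ⌊ deletion ⌋ g →
                    ∀ y → punchIn v (g y) ∉ₗ W
  avoids-deletion cover gE y ∈W =
    let (e , y∈e) = cover y
        (S′ , S′∈ , S′≈) = edgeSet gE e
        (S , _ , avoids , eq) = edge⁻ S′∈
    in avoids (lose ∈W (∈-removeAt⁻ S v (subst (_ ∈_) eq (from (S′≈ _) (y , y∈e , refl)))))

-- Splitting off one star by degrees

degree : ∀ {r n} → UniformHypergraph r n → Fin n → ℕ
degree H v = length (filter (v ∈?_) (edgeList H))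

-- `K` counts the vertices of `G` together with those of `d` petals, so a degree above `K * (m C q)`
-- lets a star dodge any copy of `G`. If no degree is that large, `large` bounds the number of edges
-- that meet a copy of `S`.
reduce : ∀ {m q} d G → NoIsolatedVertex G →
         let S = expansion (suc (suc q)) (star d)
             K = order G + d * suc q
         in suc q * (order S * K) ≤ suc m →
         (H : UniformHypergraph (suc (suc q)) (suc (suc m))) →
         ¬ (S ⊍ G ⊑ ⌊ H ⌋) → S ⊑ ⌊ H ⌋ →
         ∃[ H′ ] ¬ (G ⊑ ⌊ H′ ⌋) × #edges H ≤ (suc m C suc q) + #edges {suc (suc q)} {suc m} H′
reduce {m} {q} d G cover large H free (f , fE) =
  case any? (λ v → K * (m C q) <? degree H v) of λ
    { (yes (v , high)) → largeDegree v high
    ; (no  none)       → smallDegrees (λ v → ≮⇒≥ (λ high → none (v , high))) }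
  where
  S = expansion (suc (suc q)) (star d)
  K = order G + d * suc q

  Reduced : Set
  Reduced = ∃[ H′ ] ¬ (G ⊑ ⌊ H′ ⌋) × #edges H ≤ (suc m C suc q) + #edges {suc (suc q)} {suc m} H′

  -- Common to both cases: a copy of `G` left after the deletion would be a copy in `H` that misses
  -- `W`.
  conclude : ∀ W {v} (v∈W : v ∈ₗ W) →
             (∀ {g} → IsEmbedding G ⌊ H ⌋ g → ¬ (∀ y → g y ∉ₗ W)) →
             length (filter (meets? W) (edgeList H)) ≤ suc m C suc q → Reduced
  conclude W v∈W blocked few =
    deletion ,
    (λ (g , gE) → blocked (∘-isEmbedding punchIn-isEmbedding gE) (avoids-deletion cover gE)) ,
    subst (_≤ (suc m C suc q) + #edges deletion) (sym #edges-deletion) (+-monoˡ-≤ _ few)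
    where open Deletion H W v∈W

  largeDegree : ∀ v → K * (m C q) < degree H v → Reduced
  largeDegree v high = conclude (v ∷ []) (here refl)
    (λ {g} gE g∉ →
      let es = filter (v ∈?_) (edgeList H)
          u  = Unique.filter⁺ (v ∈?_) (distinct H)
          sz = filter-All (v ∈?_) (uniform H)
          -- The codegree bound is `m C q`: an edge through `v` and `w` has `q` further vertices
          -- among the other `m`.
          open Sunflower es v (all-filter (v ∈?_) (edgeList H)) sz
            (λ w w≢v → length-pair≤C q w≢v
              (filter-All (w ∈?_) (all-filter (v ∈?_) (edgeList H)))
              (all-filter (w ∈?_) es)
              (Unique.filter⁺ (w ∈?_) u) (filter-All (w ∈?_) sz))
          W = image G g
          (s , sE , s∉W) = star-avoiding d W
            (λ v∈W → let (i , eq) = ∈-tabulate⁻ v∈W in g∉ _ (here (sym eq)))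
            -- `W` has length `order G`, so the requirement is exactly `high`.
            (subst (λ x → (x + d * suc q) * (m C q) < length es)
              (sym (length-tabulate (g ∘ Inverse.to (vertices G)))) high)
          sE′ : IsEmbedding S ⌊ H ⌋ s
          sE′ = isEmbedding-fromList {es = edgeList H} (injective sE) λ e →
            let (T , T∈ , T≈) = edgeSet {es = es} sE e in T , proj₁ (∈-filter⁻ (v ∈?_) T∈) , T≈
      in free (_ , ⊍-isEmbedding sE′ gE
           (λ x y eq → s∉W x (subst (_∈ₗ W) (sym eq) (∈-image G g y)))))
    (length-star≤C (suc q) v
      (All.map (λ { (here v∈) → v∈ }) (all-filter (meets? (v ∷ [])) (edgeList H)))
      (Unique.filter⁺ (meets? (v ∷ [])) (distinct H))
      (filter-All (meets? (v ∷ [])) (uniform H)))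

  smallDegrees : (∀ v → degree H v ≤ K * (m C q)) → Reduced
  -- `W` is the whole copy of `S`; the vertex deleted is the image of the centre.
  smallDegrees low = conclude W (∈-image S f (inj₁ zero))
    (λ {g} gE g∉ → free (_ , ⊍-isEmbedding fE gE
      (λ x y eq → g∉ y (subst (_∈ₗ W) eq (∈-image S f x)))))
    (begin
      length (filter (meets? W) (edgeList H))
        ≤⟨ length-meeting W _ (all-filter (meets? W) (edgeList H)) (λ w _ →
             ≤-trans (length-filter-filter (w ∈?_) (meets? W) (edgeList H)) (low w)) ⟩
      length W * (K * (m C q))
        ≡⟨ cong (_* (K * (m C q))) (length-tabulate (f ∘ Inverse.to (vertices S))) ⟩
      order S * (K * (m C q))  ≡⟨ *-assoc (order S) K (m C q) ⟨
      order S * K * (m C q)    ≤⟨ *C≤C (order S * K) q large ⟩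
      suc m C suc q            ∎)
    where
    open ≤-Reasoning
    W = image S f

-- Adding a vertex that lies on every possible edge

combinations : ∀ n → ℕ → List (Subset n)
combinations zero    zero    = [] ∷ []
combinations zero    (suc _) = []
combinations (suc n) zero    = map (outside ∷_) (combinations n zero)
combinations (suc n) (suc r) =
  map (inside ∷_) (combinations n r) ++ map (outside ∷_) (combinations n (suc r))

module _ {n} {xs ys : List (Subset n)} where

  in-out-unique : Unique xs → Unique ys →
                  Unique (map (inside ∷_) xs ++ map (outside ∷_) ys)
  in-out-unique u u′ = Unique.++⁺ (Unique.map⁺ ∷-injectiveʳ u) (Unique.map⁺ ∷-injectiveʳ u′)
    (λ (S∈ , S∈′) → case ∈-map⁻ (inside ∷_) S∈ , ∈-map⁻ (outside ∷_) S∈′ of λ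
      { ((_ , _ , refl) , (_ , _ , ())) })

  in-out-uniform : ∀ {r} → UniformList r xs → UniformList (suc r) ys →
                   UniformList (suc r) (map (inside ∷_) xs ++ map (outside ∷_) ys)
  in-out-uniform h h′ = All.++⁺ (All-map (cong suc) h) (All-map (λ eq → eq) h′)

  in-out-length : length (map (inside ∷_) xs ++ map (outside ∷_) ys) ≡ length xs + length ys
  in-out-length = trans (length-++ (map (inside ∷_) xs))
    (cong₂ _+_ (length-map (inside ∷_) xs) (length-map (outside ∷_) ys))

combinations-unique : ∀ n r → Unique (combinations n r)
combinations-unique zero    zero    = [] ∷ []
combinations-unique zero    (suc r) = []
combinations-unique (suc n) zero    = Unique.map⁺ ∷-injectiveʳ (combinations-unique n zero)
combinations-unique (suc n) (suc r) =
  in-out-unique (combinations-unique n r) (combinations-unique n (suc r))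

combinations-uniform : ∀ n r → UniformList r (combinations n r)
combinations-uniform zero    zero    = refl ∷ []
combinations-uniform zero    (suc r) = []
combinations-uniform (suc n) zero    = All-map (λ eq → eq) (combinations-uniform n zero)
combinations-uniform (suc n) (suc r) =
  in-out-uniform (combinations-uniform n r) (combinations-uniform n (suc r))

length-combinations : ∀ n r → length (combinations n r) ≡ n C r
length-combinations zero    zero    = refl
length-combinations zero    (suc r) = refl
length-combinations (suc n) zero    =
  trans (length-map (outside ∷_) (combinations n zero)) (length-combinations n zero)
length-combinations (suc n) (suc r) = begin
  length (combinations (suc n) (suc r))
    ≡⟨ in-out-length {xs = combinations n r} ⟩
  length (combinations n r) + length (combinations n (suc r))
    ≡⟨ cong₂ _+_ (length-combinations n r) (length-combinations n (suc r)) ⟩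
  n C r + n C suc r
    ≡⟨ nCk+nC[k+1]≡[n+1]C[k+1] n r ⟩
  suc n C suc r ∎
  where open ≡-Reasoning

-- The apex is the new vertex `zero`. Repeated coning over extremal hypergraphs for single stars
-- gives the constructions behind the terms of the maximum.
cone : ∀ {r n} → UniformHypergraph (suc r) n → UniformHypergraph (suc r) (suc n)
cone {r} {n} H = uniformHypergraph
  (map (inside ∷_) (combinations n r) ++ map (outside ∷_) (edgeList H))
  (in-out-uniform (combinations-uniform n r) (uniform H))
  (in-out-unique (combinations-unique n r) (distinct H))

#edges-cone : ∀ {r n} (H : UniformHypergraph (suc r) n) → #edges (cone H) ≡ n C r + #edges H
#edges-cone {r} {n} H = trans (in-out-length {xs = combinations n r})
  (cong (_+ #edges H) (length-combinations n r))

-- Every vertex of an edge used by the copy is in the image of `f`. The added edges all contain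
-- `zero`, so the copy uses none of them.
cone-base : ∀ {r n F f} (H : UniformHypergraph (suc r) n) → IsEmbedding F ⌊ cone H ⌋ f →
            (∀ x → zero ≢ f x) → ∃[ f′ ] IsEmbedding F ⌊ H ⌋ f′ × (∀ x → suc (f′ x) ≡ f x)
cone-base {r} {n} {F} {f} H fE f≢0 = f′ ,
  isEmbedding-fromList
    (λ eq → injective fE (trans (sym (suc-f′ _)) (trans (cong suc eq) (suc-f′ _))))
    (λ e → let (S , S∈ , S≈) = edgeSet fE e
           in base e S S≈ (∈-++⁻ (map (inside ∷_) (combinations n r)) S∈)) ,
  suc-f′
  where
  f′ : Vertex F → Fin n
  f′ x = punchOut (f≢0 x)
  suc-f′ : ∀ x → suc (f′ x) ≡ f x
  suc-f′ x = punchIn-punchOut (f≢0 x)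
  base : ∀ e S → (∀ w → w ∈ S ⇔ (∃[ x ] _∈ₑ_ F x e × f x ≡ w)) →
         S ∈ₗ map (inside ∷_) (combinations n r) ⊎ S ∈ₗ map (outside ∷_) (edgeList H) →
         ∃[ T ] T ∈ₗ edgeList H × (∀ w → w ∈ T ⇔ (∃[ x ] _∈ₑ_ F x e × f′ x ≡ w))
  base e S S≈ (inj₁ S∈) with _ , _ , refl ← ∈-map⁻ (inside ∷_) S∈ =
    let (x , _ , eq) = to (S≈ zero) here in contradiction (sym eq) (f≢0 x)
  base e S S≈ (inj₂ S∈) with T , T∈ , refl ← ∈-map⁻ (outside ∷_) S∈ =
    T , T∈ , λ w → mk⇔
      (λ w∈ → let (x , x∈ , eq) = to (S≈ (suc w)) (there w∈)
              in x , x∈ , suc-injective (trans (suc-f′ x) eq))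
      (λ (x , x∈ , eq) → drop-there
        (from (S≈ (suc w)) (x , x∈ , trans (sym (suc-f′ x)) (cong suc eq))))

-- The apex lies in at most one component; the components before it take the
-- place of their successors.
cone-drop : ∀ k (F : Fin (suc k) → Hypergraph) → (∀ i → F (suc i) ⊑ F (Fin.inject₁ i)) →
            ∀ {r n f} (H : UniformHypergraph (suc r) n) → IsEmbedding (⨄ F) ⌊ cone H ⌋ f →
            ∃[ g ] IsEmbedding (⨄ (F ∘ suc)) ⌊ H ⌋ g × (∀ y → ∃[ x ] f x ≡ suc (g y))
cone-drop zero    F mono H fE =
  (λ ()) , record { injective = λ { {()} } ; edge = λ () } , λ ()
cone-drop (suc k) F mono {f = f} H fE =
  case any? (λ i → f (inj₁ (Inverse.to (vertices (F zero)) i)) Fin.≟ zero) of λ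
    { (yes (i , eq)) →
        let (g , gE , suc-g) = cone-base H (∘-isEmbedding fE (inj₂-isEmbedding _ _))
              (λ y 0≡ → case injective fE (trans eq 0≡) of λ ())
        in g , gE , λ y → inj₂ y , sym (suc-g y)
    ; (no none) →
        let open Inverse (vertices (F zero)) using (strictlyInverseˡ)
            (g₀ , g₀E , suc-g₀) = cone-base H (∘-isEmbedding fE (inj₁-isEmbedding _ _))
              (λ x 0≡ → none (_ , trans (cong (f ∘ inj₁) (strictlyInverseˡ x)) (sym 0≡)))
            (g , gE , g⊆) = cone-drop k (F ∘ suc) (mono ∘ suc) H
              (∘-isEmbedding fE (inj₂-isEmbedding _ _))
            (s , sE) = mono zero
        in _ , ⊍-isEmbedding (∘-isEmbedding g₀E sE) gE
             -- The replacement lies inside the image of the first component, and `g` inside the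
             -- image of the others, so injectivity of `f` separates them.
             (λ x y eq →
               let (z , fz) = g⊆ y
               in case injective fE (trans (sym (suc-g₀ (s x))) (trans (cong suc eq) (sym fz)))
                  of λ ()) ,
           λ { (inj₁ x) → inj₁ (s x) , sym (suc-g₀ (s x))
             ; (inj₂ y) → let (z , fz) = g⊆ y in inj₂ z , fz } }

-- Extremal numbers

empty : ∀ r n → UniformHypergraph r n
empty _ _ = uniformHypergraph [] [] []

empty-free : ∀ {r n} F → Edge F → ¬ (F ⊑ ⌊ empty r n ⌋)
empty-free {r} {n} F e (f , fE) with () ← proj₁ (edge {F} {⌊ empty r n ⌋} fE e)

-- Opaque, since unification would otherwise unfold the exhaustive search in ex
-- and the choice function in max.
opaque
  exᵒ : (r n : ℕ) → Hypergraph → ℕ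
  exᵒ = ex

  exᵒ≡ex : ∀ r n F → exᵒ r n F ≡ ex r n F
  exᵒ≡ex r n F = refl

  exᵒ-upper : ∀ {r n} F (H : UniformHypergraph r n) → ¬ (F ⊑ ⌊ H ⌋) → #edges H ≤ exᵒ r n F
  exᵒ-upper = ex-upper

  exᵒ-attained : ∀ {r n} F → Edge F → ∃[ H ] ¬ (F ⊑ ⌊ H ⌋) × #edges {r} {n} H ≡ exᵒ r n F
  exᵒ-attained {r} {n} F e = ex-attained F (empty r n) (empty-free {r} {n} F e)

  maximum : List ℕ → ℕ
  maximum = max 0

  maximum≡max : ∀ xs → maximum xs ≡ max 0 xs
  maximum≡max xs = refl

  maximum-∷ : ∀ x xs → maximum (x ∷ xs) ≡ x ⊔ maximum xs
  maximum-∷ x xs = ≤-antisym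
    (max≤v⁺ z≤n (m≤m⊔n x _ ∷ All.map (λ le → ≤-trans le (m≤n⊔m x _)) (xs≤max 0 xs)))
    (⊔-lub (v≤max⁺ 0 (x ∷ xs) (inj₂ (here ≤-refl)))
           (max≤v⁺ {max 0 (x ∷ xs)} {0} {xs} z≤n (All.tail (xs≤max 0 (x ∷ xs)))))

  maximum-[x] : ∀ x → maximum (x ∷ []) ≡ x
  maximum-[x] x = trans (maximum-∷ x []) (⊔-identityʳ x)

-- As `F` has an edge, the empty hypergraph is `F`-free and the extremal number is attained.
ex-least : ∀ {r n B} F → Edge F → (∀ (H : UniformHypergraph r n) → ¬ (F ⊑ ⌊ H ⌋) → #edges H ≤ B) →
           exᵒ r n F ≤ B
ex-least {r} {n} {B} F e bound =
  let (H , free , eq) = exᵒ-attained {r} {n} F e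
  in subst (_≤ B) eq (bound H free)

ex-mono : ∀ {r n} F G → Edge F → F ⊑ G → exᵒ r n F ≤ exᵒ r n G
ex-mono F G e F⊑G = ex-least F e λ H free → exᵒ-upper G H λ G⊑H → free (⊑-trans F⊑G G⊑H)

-- The index set is nonempty because the maximum of the empty list is the default 0, which does not
-- shift by `c`.
maximum-tabulate-+ : ∀ k c (g : Fin (suc k) → ℕ) →
                     maximum (tabulate (λ i → c + g i)) ≡ c + maximum (tabulate g)
maximum-tabulate-+ zero c g =
  trans (maximum-[x] (c + g zero)) (cong (c +_) (sym (maximum-[x] (g zero))))
maximum-tabulate-+ (suc k) c g = begin
  maximum (tabulate (λ i → c + g i))
    ≡⟨ maximum-∷ (c + g zero) _ ⟩
  (c + g zero) ⊔ maximum (tabulate (λ i → c + g (suc i)))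
    ≡⟨ cong ((c + g zero) ⊔_) (maximum-tabulate-+ k c (g ∘ suc)) ⟩
  (c + g zero) ⊔ (c + maximum (tabulate (g ∘ suc)))
    ≡⟨ +-distribˡ-⊔ c _ _ ⟨
  c + (g zero ⊔ maximum (tabulate (g ∘ suc)))
    ≡⟨ cong (c +_) (maximum-∷ (g zero) _) ⟨
  c + maximum (tabulate g) ∎
  where open ≡-Reasoning

-- A hypergraph without `S` is bounded by the first term; one that contains `S` is bounded by the
-- second, through `reduce`.
ex-⊍-upper : ∀ {m q} d G → 1 ≤ d → NoIsolatedVertex G →
             let r = suc (suc q)
                 S = expansion r (star d)
             in suc q * (order S * (order G + d * suc q)) ≤ suc m →
             exᵒ r (suc (suc m)) (S ⊍ G)
               ≤ exᵒ r (suc (suc m)) S ⊔ ((suc m C suc q) + exᵒ r (suc m) G)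
ex-⊍-upper {m} {q} d@(suc _) G _ cover large = ex-least (S ⊍ G) (inj₁ zero) λ H free →
  case S ⊑? ⌊ H ⌋ of λ
    { (no S⋢H)  → ≤-trans (exᵒ-upper S H S⋢H) (m≤m⊔n _ _)
    ; (yes S⊑H) →
        let (H′ , free′ , le) = reduce d G cover large H free S⊑H
        in ≤-trans le (≤-trans (+-monoʳ-≤ (suc m C suc q) (exᵒ-upper G H′ free′))
             (m≤n⊔m (exᵒ (suc (suc q)) (suc (suc m)) S) _)) }
  where S = expansion (suc (suc q)) (star d)

-- Expanded stars and their unions

-- The first `c` edges of the larger star, each with its own added vertices, form the smaller one.
expansion-star-mono : ∀ r {c d} → c ≤ d → expansion r (star c) ⊑ expansion r (star d)
expansion-star-mono r {c} {d} c≤d = f , record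
  { injective = λ {x} {y} → inj x y
  ; edge = λ e → inject≤ e c≤d , λ w → mk⇔ (to′ e w) (from′ e w)
  }
  where
  F = expansion r (star c)
  G = expansion r (star d)
  f : Vertex F → Vertex G
  f (inj₁ v)       = inj₁ (inject≤ v (s≤s c≤d))
  f (inj₂ (e , j)) = inj₂ (inject≤ e c≤d , j)
  inj : ∀ x y → f x ≡ f y → x ≡ y
  inj (inj₁ x) (inj₁ y) eq =
    cong inj₁ (inject≤-injective (s≤s c≤d) (s≤s c≤d) x y (inj₁-injective eq))
  inj (inj₁ _) (inj₂ _) ()
  inj (inj₂ _) (inj₁ _) ()
  inj (inj₂ (e , j)) (inj₂ (e′ , j′)) eq =
    cong₂ (λ a b → inj₂ (a , b))
      (inject≤-injective c≤d c≤d e e′ (cong proj₁ (inj₂-injective eq)))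
      (cong proj₂ (inj₂-injective eq))
  to′ : ∀ e w → _∈ₑ_ G w (inject≤ e c≤d) → ∃[ v ] _∈ₑ_ F v e × f v ≡ w
  to′ e (inj₁ _) (inj₁ refl) = inj₁ zero , inj₁ refl , refl
  to′ e (inj₁ _) (inj₂ refl) = inj₁ (suc e) , inj₂ refl , refl
  to′ e (inj₂ (_ , j)) refl  = inj₂ (e , j) , refl , refl
  from′ : ∀ e w → ∃[ v ] _∈ₑ_ F v e × f v ≡ w → _∈ₑ_ G w (inject≤ e c≤d)
  from′ e _ (inj₁ _ , inj₁ refl , refl) = inj₁ refl
  from′ e _ (inj₁ _ , inj₂ refl , refl) = inj₂ refl
  from′ e _ (inj₂ _ , refl , refl)      = refl

star-edge : ∀ {ℓ} → 1 ≤ ℓ → Edge (star ℓ)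
star-edge (s≤s _) = zero

expansion-star-noIsolatedVertex : ∀ r {ℓ} → 1 ≤ ℓ → NoIsolatedVertex (expansion r (star ℓ))
expansion-star-noIsolatedVertex r 1≤ℓ (inj₁ zero)    = star-edge 1≤ℓ , inj₁ refl
expansion-star-noIsolatedVertex r 1≤ℓ (inj₁ (suc i)) = i , inj₂ refl
expansion-star-noIsolatedVertex r 1≤ℓ (inj₂ (e , _)) = e , refl

⨄-noIsolatedVertex : ∀ {k} (F : Fin k → Hypergraph) → (∀ i → NoIsolatedVertex (F i)) →
                     NoIsolatedVertex (⨄ F)
⨄-noIsolatedVertex {suc k} F cover (inj₁ v) =
  let (e , v∈e) = cover zero v in inj₁ e , v∈e
⨄-noIsolatedVertex {suc k} F cover (inj₂ v) =
  let (e , v∈e) = ⨄-noIsolatedVertex (F ∘ suc) (cover ∘ suc) v in inj₂ e , v∈e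

-- The recursion for the right-hand side

-- A term of the maximum, with indices from 0, so that n-i+1 becomes `n ∸ toℕ i`. The extremal
-- numbers are abstracted to `e`, which makes the recursion pure arithmetic.
candidate : ∀ {k} → ℕ → (Fin k → ℕ → ℕ) → ℕ → Fin k → ℕ
candidate r e n i = ((n C r) ∸ ((n ∸ toℕ i) C r)) + e i (n ∸ toℕ i)

candidate-zero : ∀ {k} r (e : Fin (suc k) → ℕ → ℕ) n → candidate r e n zero ≡ e zero n
candidate-zero r e n = cong (_+ e zero n) (n∸n≡0 (n C r))

candidate-suc : ∀ {k} r (e : Fin (suc k) → ℕ → ℕ) n i →
                candidate (suc r) e (suc n) (suc i) ≡ (n C r) + candidate (suc r) (e ∘ suc) n i
candidate-suc r e n i = trans (cong (_+ e (suc i) (n ∸ toℕ i)) (begin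
    (suc n C suc r) ∸ rest           ≡⟨ cong (_∸ rest) (nCk+nC[k+1]≡[n+1]C[k+1] n r) ⟨
    -- Subtraction is truncated, so reassociating requires `rest` to be at most `n C suc r`.
    ((n C r) + (n C suc r)) ∸ rest   ≡⟨ +-∸-assoc (n C r) (C-mono (suc r) (m∸n≤m n (toℕ i))) ⟩
    (n C r) + ((n C suc r) ∸ rest)   ∎))
  (+-assoc (n C r) _ _)
  where
  open ≡-Reasoning
  rest = (n ∸ toℕ i) C suc r

maximum-candidate : ∀ {k} r (e : Fin (suc (suc k)) → ℕ → ℕ) n →
                    maximum (tabulate (candidate (suc r) e (suc n)))
                      ≡ e zero (suc n)
                        ⊔ ((n C r) + maximum (tabulate (candidate (suc r) (e ∘ suc) n)))
maximum-candidate {k} r e n = begin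
  maximum (tabulate (candidate (suc r) e (suc n)))
    ≡⟨ maximum-∷ (candidate (suc r) e (suc n) zero) _ ⟩
  candidate (suc r) e (suc n) zero ⊔ maximum (tabulate (candidate (suc r) e (suc n) ∘ suc))
    ≡⟨ cong₂ (λ x xs → x ⊔ maximum xs) (candidate-zero (suc r) e (suc n))
                                       (tabulate-cong (candidate-suc r e n)) ⟩
  e zero (suc n) ⊔ maximum (tabulate (λ i → (n C r) + candidate (suc r) (e ∘ suc) n i))
    ≡⟨ cong (e zero (suc n) ⊔_) (maximum-tabulate-+ k (n C r) (candidate (suc r) (e ∘ suc) n)) ⟩
  e zero (suc n) ⊔ ((n C r) + maximum (tabulate (candidate (suc r) (e ∘ suc) n))) ∎
  where open ≡-Reasoning

max-candidate : ∀ {k} r (e e′ : Fin k → ℕ → ℕ) → (∀ i m → e i m ≡ e′ i m) → ∀ n →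
                maximum (tabulate (candidate r e n)) ≡ max 0 (tabulate (candidate r e′ n))
max-candidate r e e′ e≗e′ n = trans
  (cong maximum (tabulate-cong λ i →
    cong (((n C r) ∸ ((n ∸ toℕ i) C r)) +_) (e≗e′ i (n ∸ toℕ i))))
  (maximum≡max _)

-- Induction on the number of stars

-- Two constructions: an extremal `F`-free hypergraph, and the cone over an extremal `G`-free one,
-- which `drop` shows to be free of the union.
ex-⊍-lower : ∀ {r n} F G → Edge F → Edge G →
             (∀ (H : UniformHypergraph (suc r) n) → F ⊍ G ⊑ ⌊ cone H ⌋ → G ⊑ ⌊ H ⌋) →
             exᵒ (suc r) (suc n) F ⊔ ((n C r) + exᵒ (suc r) n G) ≤ exᵒ (suc r) (suc n) (F ⊍ G)
ex-⊍-lower {r} {n} F G e e′ drop = ⊔-lub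
  (ex-mono F (F ⊍ G) e (_ , inj₁-isEmbedding F G))
  (let (H , free , eq) = exᵒ-attained {suc r} {n} G e′ in
   subst (λ x → (n C r) + x ≤ exᵒ (suc r) (suc n) (F ⊍ G)) eq
     (subst (_≤ exᵒ (suc r) (suc n) (F ⊍ G)) (#edges-cone H)
       (exᵒ-upper (F ⊍ G) (cone H) (free ∘ drop H))))

ex-⨄-star : ∀ k q (d : Fin (suc k) → ℕ) → (∀ i → 1 ≤ d i) →
            (∀ i → d (suc i) ≤ d (Fin.inject₁ i)) →
            let r = suc (suc q) in
            ∃[ N ] (∀ n → N ≤ n →
              exᵒ r n (⨄ (λ i → expansion r (star (d i))))
                ≡ maximum (tabulate (candidate r (λ i m → exᵒ r m (expansion r (star (d i)))) n)))
ex-⨄-star zero q d 1≤d _ = 0 , λ n _ →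
  let r = suc (suc q)
      F = expansion r (star (d zero))
      e = star-edge (1≤d zero)
  in trans
    -- The union of a single star is `F ⊍ ∅`, which embeds in the same hypergraphs as `F`.
    (≤-antisym
      (ex-least (F ⊍ ∅) (inj₁ e) λ H free → exᵒ-upper F H λ F⊑H → free (⊍∅-⊑ F⊑H))
      (ex-mono F (F ⊍ ∅) e (_ , inj₁-isEmbedding F ∅)))
    (trans (sym (candidate-zero r (λ i m → exᵒ r m (expansion r (star (d i)))) n))
      (sym (maximum-[x] _)))
ex-⨄-star (suc k) q d 1≤d antitone =
  let r = suc (suc q)
      F = expansion r (star (d zero))
      G = ⨄ (λ i → expansion r (star (d (suc i))))
      (N , ih) = ex-⨄-star k q (d ∘ suc) (1≤d ∘ suc) (antitone ∘ suc)
      L = suc q * (order F * (order G + d zero * suc q))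
  -- `L` is the threshold in `reduce` and does not depend on `n`. The sum secures both `L` and the
  -- induction hypothesis at `suc m`; the two successors give `n` the form that `reduce` expects.
  in suc (suc (N + L)) , λ { (suc (suc m)) (s≤s (s≤s N+L≤m)) →
    trans
      (≤-antisym
        (ex-⊍-upper (d zero) G (1≤d zero)
          (⨄-noIsolatedVertex (λ i → expansion r (star (d (suc i)))) λ i →
            expansion-star-noIsolatedVertex r (1≤d (suc i)))
          (m≤n⇒m≤1+n (m+n≤o⇒n≤o N N+L≤m)))
        (ex-⊍-lower F G (star-edge (1≤d zero)) (inj₁ (star-edge (1≤d (suc zero)))) λ H (f , fE) →
          let (g , gE , _) = cone-drop (suc k) (λ i → expansion r (star (d i)))
                (λ i → expansion-star-mono r (antitone i)) H fE
          in g , gE))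
      (trans
        (cong (λ x → exᵒ r (suc (suc m)) F ⊔ ((suc m C suc q) + x))
          (ih (suc m) (m≤n⇒m≤1+n (m+n≤o⇒m≤o N N+L≤m))))
        (sym (maximum-candidate (suc q) (λ i m → exᵒ r m (expansion r (star (d i)))) (suc m)))) }

theorem1p5 : (k r : ℕ) → 1 ≤ k → 2 ≤ r → (d : Fin k → ℕ) → (∀ i → 1 ≤ d i) → (∀ i j → i Fin.≤ j → d j ≤ d i) →
    ∃[ N ] (∀ n → N ≤ n →
      ex r n (⨄ (λ i → expansion r (star (d i))))
        ≡ max 0 (tabulate (λ (i : Fin k) →
            ((n C r) ∸ ((n ∸ toℕ i) C r)) + ex r (n ∸ toℕ i) (expansion r (star (d i))))))
theorem1p5 (suc k) (suc (suc q)) _ (s≤s (s≤s _)) d 1≤d antitone =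
  let r = suc (suc q)
      (N , eq) = ex-⨄-star k q d 1≤d λ i → antitone (Fin.inject₁ i) (suc i)
        (≤-trans (≤-reflexive (toℕ-inject₁ i)) (n≤1+n (toℕ i)))
  in N , λ n N≤n → trans
    (sym (exᵒ≡ex r n (⨄ (λ i → expansion r (star (d i))))))
    (trans (eq n N≤n)
      (max-candidate r (λ i m → exᵒ r m (expansion r (star (d i))))
                       (λ i m → ex r m (expansion r (star (d i))))
        (λ i m → exᵒ≡ex r m (expansion r (star (d i)))) n))
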